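{- Let $E$ and $F$ be types, let $K, L$ be simplicial complexes over $E$ and $Z, W$ simplicial complexes over $F$ such that $K \cong Z$ and $L \cong W$. Suppose there is an injective function $f : E \to F$. If $K \cong_{\mathrm{st}} L$ (stellar equivalence over $E$), then $Z \cong_{\mathrm{st}} W$ (stellar equivalence over $F$).
   Context: A simplicial complex over a type (set) $E$ is a set $K$ of nonempty finite subsets of $E$ (its faces) such that every nonempty subset of a face is a face. It may be empty or infinite, and not every element of $E$ need be a vertex. $V(K) = \{x \in E \mid \{x\} \in K\}$. For a finite set $s \subseteq E$: $\mathrm{Lk}(K,s) = \{t \in K \mid s \cup t \in K,\ s \cap t = \emptyset\}$; $\partial s = \{t \subseteq s \mid t \ne \emptyset,\ t \neq s\}$. A simplicial map from $K$ (over $E$) to $L$ (over $F$) is a function $E \to F$ sending each face of $K$ to a face of $L$. $K \cong L$ (isomorphism) means there are simplicial maps $f : E \to F$ from $K$ to $L$ and $g : F \to E$ from $L$ to $K$ with $g(f(x)) = x$ for all $x \in V(K)$ and $f(g(y)) = y$ for all $y \in V(L)$. For $s \in K$ and $x \in E \setminus V(K)$, the stellar subdivision $\sigma_s K$ of $K$ at $s$ with barycenter $x$ is the complex over $E$ whose faces are the faces of $K$ not containing $s$ together with all nonempty sets $a \cup b \cup c$ with $a \in \mathrm{Lk}(K,s) \cup \{\emptyset\}$, $b \in \partial s \cup \{\emptyset\}$, $c \in \{\emptyset, \{x\}\}$. For complexes $K, L$ over the same type $E$, there is a stellar move from $K$ to $L$ if $L$ is a stellar subdivision of $K$ (for some face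 $s$ of $K$ and some barycenter in $E \setminus V(K)$), or $K$ is a stellar subdivision of $L$ (a stellar weld), or $K \cong L$. Stellar equivalence $\cong_{\mathrm{st}}$ is the reflexive transitive closure of the stellar move relation on complexes over $E$. -}

module Defs where

open import Data.List.Base using (List; []; _∷_; [_]; _++_; map)
open import Data.List.Membership.Propositional.Properties using (∈-++⁻; ∈-++⁺ˡ; ∈-++⁺ʳ)
open import Data.List.Relation.Binary.BagAndSetEquality using (_∼[_]_; set)
open import Data.List.Relation.Binary.Disjoint.Propositional using (Disjoint)
open import Data.List.Relation.Binary.Subset.Propositional using (_⊆_)
open import Data.List.Relation.Binary.Subset.Propositional.Properties using (++⁺)
open import Data.List.Relation.Unary.Any using (here; there)
open import Data.Product using (∃-syntax; _×_; _,_)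
open import Data.Sum using (_⊎_; inj₁; inj₂)
open import Function.Base using (_∘_; id)
open import Function.Bundles using (mk⇔; Equivalence)
open import Level using (Level; _⊔_; suc)
open import Relation.Binary.Construct.Closure.ReflexiveTransitive using (Star)
open import Relation.Binary.PropositionalEquality using (_≡_; _≢_; refl)
open import Relation.Nullary using (¬_; contradiction)
open import Relation.Unary using (Pred; _∈_; _∉_; _∪_; _≐_; ｛_｝)

private
  variable
    a b ℓ ℓ₁ ℓ₂ : Level

-- A finite subset of E is represented by a list of its elements, in any order
-- and with repetitions allowed.  Equality of finite subsets is _≋_, union is
-- _++_, the image under a function is map, and the empty set is [], the only
-- list without elements.

infix 4 _≋_

_≋_ : {E : Set a} → List E → List E → Set a
s ≋ t = s ∼[ set ] t

-- Since s ≋ t gives t ⊆ s, the field down-closed also makes being a face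
-- independent of the list chosen to represent a finite subset.

record SimplicialComplex (E : Set a) (ℓ : Level) : Set (a ⊔ suc ℓ) where
  field
    faces       : Pred (List E) ℓ
    nonempty    : ∀ {s} → s ∈ faces → s ≢ []
    down-closed : ∀ {s t} → s ∈ faces → t ⊆ s → t ≢ [] → t ∈ faces

open SimplicialComplex public

V : {E : Set a} → SimplicialComplex E ℓ → Pred E ℓ
V K x = [ x ] ∈ faces K

Lk : {E : Set a} → SimplicialComplex E ℓ → List E → Pred (List E) (a ⊔ ℓ)
Lk K s t = t ∈ faces K × s ++ t ∈ faces K × Disjoint s t

∂ : {E : Set a} → List E → Pred (List E) a
∂ s t = t ⊆ s × t ≢ [] × ¬ (t ≋ s)

IsSimplicialMap : {E : Set a} {F : Set b} →
                  SimplicialComplex E ℓ₁ → SimplicialComplex F ℓ₂ →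
                  (E → F) → Set (a ⊔ ℓ₁ ⊔ ℓ₂)
IsSimplicialMap K L f = ∀ {s} → s ∈ faces K → map f s ∈ faces L

infix 4 _≅_

record _≅_ {E : Set a} {F : Set b}
           (K : SimplicialComplex E ℓ₁) (L : SimplicialComplex F ℓ₂) :
           Set (a ⊔ b ⊔ ℓ₁ ⊔ ℓ₂) where
  field
    to              : E → F
    from            : F → E
    to-simplicial   : IsSimplicialMap K L to
    from-simplicial : IsSimplicialMap L K from
    from∘to         : ∀ {x} → x ∈ V K → from (to x) ≡ x
    to∘from         : ∀ {y} → y ∈ V L → to (from y) ≡ y

stellarFaces : {E : Set a} → SimplicialComplex E ℓ → List E → E → Pred (List E) (a ⊔ ℓ)
stellarFaces K s x t =
  (t ∈ faces K × ¬ (s ⊆ t)) ⊎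
  (t ≢ [] × ∃[ u ] ∃[ v ] ∃[ w ]
    u ∈ Lk K s ∪ ｛ [] ｝ × v ∈ ∂ s ∪ ｛ [] ｝ × w ∈ ｛ [] ｝ ∪ ｛ [ x ] ｝ ×
    t ≋ u ++ v ++ w)

module _ {E : Set a} where

  ++-cong : {p p′ q q′ : List E} → p ≋ p′ → q ≋ q′ → p ++ q ≋ p′ ++ q′
  ++-cong e e′ = mk⇔ (++⁺ (Equivalence.to e) (Equivalence.to e′))
                     (++⁺ (Equivalence.from e) (Equivalence.from e′))

  ≋-trans : {p q r : List E} → p ≋ q → q ≋ r → p ≋ r
  ≋-trans e e′ = mk⇔ (Equivalence.to e′ ∘ Equivalence.to e)
                     (Equivalence.from e ∘ Equivalence.from e′)

  ≋-refl : {p : List E} → p ≋ p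
  ≋-refl = mk⇔ id id

  ∷-++-≋ : ∀ {x : E} p {q} → x ∷ p ++ q ≋ p ++ x ∷ q
  ∷-++-≋ {x} p {q} = mk⇔ fwd bwd
    where
    fwd : x ∷ p ++ q ⊆ p ++ x ∷ q
    fwd (here refl) = ∈-++⁺ʳ p (here refl)
    fwd (there i) = ++⁺ {ws = p} id there i
    bwd : p ++ x ∷ q ⊆ x ∷ p ++ q
    bwd i with ∈-++⁻ p i
    ... | inj₁ j         = there (∈-++⁺ˡ j)
    ... | inj₂ (here e)  = here e
    ... | inj₂ (there j) = there (∈-++⁺ʳ p j)

  ⊆-++-split : ∀ (u v : List E) {t} → t ⊆ u ++ v →
               ∃[ p ] ∃[ q ] p ⊆ u × q ⊆ v × t ≋ p ++ q
  ⊆-++-split u v {[]} _ = [] , [] , (λ ()) , (λ ()) , ≋-refl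
  ⊆-++-split u v {x ∷ t} t⊆
    with ∈-++⁻ u (t⊆ (here refl)) | ⊆-++-split u v {t} (t⊆ ∘ there)
  ... | inj₁ x∈u | p , q , p⊆ , q⊆ , e =
    x ∷ p , q , (λ { (here refl) → x∈u ; (there i) → p⊆ i }) , q⊆
    , ++-cong (≋-refl {p = [ x ]}) e
  ... | inj₂ x∈v | p , q , p⊆ , q⊆ , e =
    p , x ∷ q , p⊆ , (λ { (here refl) → x∈v ; (there i) → q⊆ i })
    , ≋-trans (++-cong (≋-refl {p = [ x ]}) e) (∷-++-≋ p)

  Lk-⊆ : ∀ (K : SimplicialComplex E ℓ) s {u p} →
         u ∈ Lk K s ∪ ｛ [] ｝ → p ⊆ u → p ∈ Lk K s ∪ ｛ [] ｝
  Lk-⊆ K s {p = []} _ _ = inj₂ refl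
  Lk-⊆ K s {p = y ∷ p} (inj₂ refl) p⊆ = contradiction (p⊆ (here refl)) λ ()
  Lk-⊆ K s {p = y ∷ p} (inj₁ (u∈K , su∈K , disj)) p⊆ = inj₁
    ( down-closed K u∈K p⊆ (λ ())
    , down-closed K su∈K (++⁺ {ws = s} id p⊆) (s++≢[] s)
    , (λ (i , j) → disj (i , p⊆ j)) )
    where
    s++≢[] : ∀ s → s ++ y ∷ p ≢ []
    s++≢[] [] ()
    s++≢[] (_ ∷ _) ()

  ∂-⊆ : ∀ (s : List E) {v p} → v ∈ ∂ s ∪ ｛ [] ｝ → p ⊆ v → p ∈ ∂ s ∪ ｛ [] ｝
  ∂-⊆ s {p = []} _ _ = inj₂ refl
  ∂-⊆ s {p = y ∷ p} (inj₂ refl) p⊆ = contradiction (p⊆ (here refl)) λ ()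
  ∂-⊆ s {p = y ∷ p} (inj₁ (v⊆s , _ , v≢s)) p⊆ = inj₁
    ( v⊆s ∘ p⊆ , (λ ()) , λ e → v≢s (mk⇔ v⊆s (p⊆ ∘ Equivalence.from e)) )

  ｛｝-⊆ : ∀ (x : E) {w p} → w ∈ ｛ [] ｝ ∪ ｛ [ x ] ｝ → p ⊆ w →
         ∃[ q ] q ∈ ｛ [] ｝ ∪ ｛ [ x ] ｝ × p ≋ q
  ｛｝-⊆ x {p = []} _ _ = [] , inj₁ refl , ≋-refl
  ｛｝-⊆ x {p = y ∷ p} (inj₁ refl) p⊆ = contradiction (p⊆ (here refl)) λ ()
  ｛｝-⊆ x {p = y ∷ p} (inj₂ refl) p⊆ with p⊆ (here refl)
  ... | here refl = [ x ] , inj₂ refl , mk⇔ p⊆ λ { (here e) → here e }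

stellarSubdivision : {E : Set a} → SimplicialComplex E ℓ → List E → E →
                     SimplicialComplex E (a ⊔ ℓ)
stellarSubdivision K s x .faces = stellarFaces K s x
stellarSubdivision K s x .nonempty (inj₁ (t∈K , _)) = nonempty K t∈K
stellarSubdivision K s x .nonempty (inj₂ (t≢[] , _)) = t≢[]
stellarSubdivision K s x .down-closed (inj₁ (t∈K , s⊈t)) t′⊆t t′≢[] =
  inj₁ (down-closed K t∈K t′⊆t t′≢[] , λ s⊆t′ → s⊈t (t′⊆t ∘ s⊆t′))
stellarSubdivision K s x .down-closed
  (inj₂ (_ , u , v , w , u∈ , v∈ , w∈ , t≋)) t′⊆t t′≢[]
  with u′ , r , u′⊆u , r⊆ , e₁ ← ⊆-++-split u (v ++ w) (Equivalence.to t≋ ∘ t′⊆t)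
  with v′ , r′ , v′⊆v , r′⊆w , e₂ ← ⊆-++-split v w r⊆
  with w′ , w′∈ , e₃ ← ｛｝-⊆ x w∈ r′⊆w =
  inj₂ ( t′≢[] , u′ , v′ , w′ , Lk-⊆ K s u∈ u′⊆u , ∂-⊆ s v∈ v′⊆v , w′∈
       , ≋-trans e₁ (++-cong ≋-refl (≋-trans e₂ (++-cong ≋-refl e₃))) )

-- Equality of complexes over E is equality of their sets of faces.

IsStellarSubdivision : {E : Set a} → (L K : SimplicialComplex E ℓ) → Set (a ⊔ ℓ)
IsStellarSubdivision L K =
  ∃[ s ] ∃[ x ] s ∈ faces K × x ∉ V K × faces L ≐ faces (stellarSubdivision K s x)

data StellarMove {E : Set a} (K L : SimplicialComplex E ℓ) : Set (a ⊔ ℓ) where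
  subdivision : IsStellarSubdivision L K → StellarMove K L
  weld        : IsStellarSubdivision K L → StellarMove K L
  iso         : K ≅ L → StellarMove K L

infix 4 _≅st_

_≅st_ : {E : Set a} → SimplicialComplex E ℓ → SimplicialComplex E ℓ → Set (a ⊔ suc ℓ)
_≅st_ = Star StellarMove

{-# OPTIONS --safe #-}

-- K ≅ Z provides a function F → E, which turns the injection f into a split
-- one, with retraction g : F → E.  Every complex over E is then isomorphic to
-- its image under f, and taking images commutes with stellar subdivision; so a
-- chain of moves from K to L gives a chain from f(K) to f(L), to be completed
-- by Z ≅ K ≅ f(K) and f(L) ≅ L ≅ W.

module Submission where

open import Defs
open import Axiom.ExcludedMiddle using (ExcludedMiddle)
open import Data.List.Base using (List; []; _∷_; [_]; _++_; map)
open import Data.List.Membership.Propositional using () renaming (_∈_ to _∈ₗ_)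
open import Data.List.Membership.Propositional.Properties
  using (∈-map⁺; ∈-map⁻; ∈-++⁻)
open import Data.List.Properties using (map-∘; map-++; map-cong; map-id; map-id-local)
open import Data.List.Relation.Binary.Disjoint.Propositional using (Disjoint)
open import Data.List.Relation.Binary.Subset.Propositional using (_⊆_)
open import Data.List.Relation.Binary.Subset.Propositional.Properties using (map⁺)
open import Data.List.Relation.Unary.All using (tabulate)
open import Data.List.Relation.Unary.Any using (here)
open import Data.Product using (∃-syntax; _×_; _,_; proj₁; proj₂)
open import Data.Sum using (inj₁; inj₂; [_,_]′)
open import Function.Base using (_∘_)
open import Function.Bundles using (mk⇔; Equivalence)
open import Function.Definitions using (Injective)
open import Level using (Level; _⊔_; Lift; lift; lower)
open import Relation.Binary.Construct.Closure.ReflexiveTransitive using (ε; _◅_; _◅◅_)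
open import Relation.Binary.PropositionalEquality
  using (_≡_; _≢_; refl; sym; trans; cong; subst; subst₂)
open import Relation.Nullary using (Dec; yes; no; contradiction)
open import Relation.Nullary.Decidable using (map′; True; toWitness; fromWitness)
open import Relation.Unary using (Pred; _∈_; _∪_; _≐_; ｛_｝)

private
  variable
    a b c ℓ ℓ₁ ℓ₂ ℓ₃ : Level
    E : Set a
    F : Set b
    G : Set c

map-≢[] : (h : E → F) {s : List E} → s ≢ [] → map h s ≢ []
map-≢[] h {[]}    s≢[] _ = s≢[] refl
map-≢[] h {_ ∷ _} _ ()

map-≋ : (h : E → F) {s t : List E} → s ≋ t → map h s ≋ map h t
map-≋ h e = mk⇔ (map⁺ h (Equivalence.to e)) (map⁺ h (Equivalence.from e))

≅-sym : {K : SimplicialComplex E ℓ₁} {L : SimplicialComplex F ℓ₂} → K ≅ L → L ≅ K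
≅-sym i = record
  { to = from ; from = to
  ; to-simplicial = from-simplicial ; from-simplicial = to-simplicial
  ; from∘to = to∘from ; to∘from = from∘to }
  where open _≅_ i

IsSimplicialMap-∘ :
  (K : SimplicialComplex E ℓ₁) (L : SimplicialComplex F ℓ₂) (M : SimplicialComplex G ℓ₃)
  {h : E → F} {k : F → G} →
  IsSimplicialMap K L h → IsSimplicialMap L M k → IsSimplicialMap K M (k ∘ h)
IsSimplicialMap-∘ K L M h-simp k-simp {s} s∈K =
  subst (_∈ faces M) (sym (map-∘ s)) (k-simp (h-simp s∈K))

≅-trans : {K : SimplicialComplex E ℓ₁} {L : SimplicialComplex F ℓ₂}
          {M : SimplicialComplex G ℓ₃} → K ≅ L → L ≅ M → K ≅ M
≅-trans {K = K} {L} {M} i j = record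
  { to = J.to ∘ I.to ; from = I.from ∘ J.from
  ; to-simplicial = IsSimplicialMap-∘ K L M I.to-simplicial J.to-simplicial
  ; from-simplicial = IsSimplicialMap-∘ M L K J.from-simplicial I.from-simplicial
  -- The inverse laws hold on vertices only. That `I.to` sends the vertex `x` to a vertex of `L` is
  -- `I.to-simplicial` at the singleton `[ x ]`.
  ; from∘to = λ x∈K → trans (cong I.from (J.from∘to (I.to-simplicial x∈K))) (I.from∘to x∈K)
  ; to∘from = λ z∈M → trans (cong J.to (I.to∘from (J.from-simplicial z∈M))) (J.to∘from z∈M) }
  where
  module I = _≅_ i
  module J = _≅_ j

module SplitInjection {E : Set a} {F : Set b}
  (f : E → F) (g : F → E) (g∘f : ∀ x → g (f x) ≡ x) where

  -- Since `g` retracts `f`, the equation singles out exactly the values of `f`, without naming a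
  -- preimage.
  InRange : Pred (List F) b
  InRange t = ∀ {y} → y ∈ₗ t → f (g y) ≡ y

  f-injective : Injective _≡_ _≡_ f
  f-injective {x} {y} e = trans (sym (g∘f x)) (trans (cong g e) (g∘f y))

  map-g∘f : ∀ s → map g (map f s) ≡ s
  map-g∘f s = trans (sym (map-∘ s)) (trans (map-cong g∘f s) (map-id s))

  map-f∘g : ∀ {t} → InRange t → map f (map g t) ≡ t
  map-f∘g {t} r = trans (sym (map-∘ t)) (map-id-local (tabulate r))

  map-InRange : ∀ s → InRange (map f s)
  map-InRange s y∈ with x , _ , refl ← ∈-map⁻ f y∈ = cong f (g∘f x)

  ∂-map : ∀ {s v} → v ∈ ∂ s ∪ ｛ [] ｝ → map f v ∈ ∂ (map f s) ∪ ｛ [] ｝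
  ∂-map (inj₂ refl) = inj₂ refl
  ∂-map {s} {v} (inj₁ (v⊆s , v≢[] , v≄s)) = inj₁
    ( map⁺ f v⊆s , map-≢[] f v≢[]
    , λ e → v≄s (subst₂ _≋_ (map-g∘f v) (map-g∘f s) (map-≋ g e)) )

  -- Off the range, `g` may merge points. Inclusion in `map f s` keeps `v` in range, so `map f`
  -- undoes `map g` and properness survives.
  ∂-unmap : ∀ {s v} → v ∈ ∂ (map f s) ∪ ｛ [] ｝ → InRange v × map g v ∈ ∂ s ∪ ｛ [] ｝
  ∂-unmap (inj₂ refl) = (λ ()) , inj₂ refl
  ∂-unmap {s} {v} (inj₁ (v⊆ , v≢[] , v≄)) = v-inRange , inj₁
    ( subst (map g v ⊆_) (map-g∘f s) (map⁺ g v⊆) , map-≢[] g v≢[]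
    , λ e → v≄ (subst (_≋ map f s) (map-f∘g v-inRange) (map-≋ f e)) )
    where
    v-inRange : InRange v
    v-inRange = map-InRange s ∘ v⊆

  barycenter-map : ∀ {x w} → w ∈ ｛ [] ｝ ∪ ｛ [ x ] ｝ → map f w ∈ ｛ [] ｝ ∪ ｛ [ f x ] ｝
  barycenter-map (inj₁ refl) = inj₁ refl
  barycenter-map (inj₂ refl) = inj₂ refl

  barycenter-unmap : ∀ {x w} → w ∈ ｛ [] ｝ ∪ ｛ [ f x ] ｝ →
                     InRange w × map g w ∈ ｛ [] ｝ ∪ ｛ [ x ] ｝
  barycenter-unmap (inj₁ refl) = (λ ()) , inj₁ refl
  barycenter-unmap {x} (inj₂ refl) = map-InRange [ x ] , inj₂ (sym (map-g∘f [ x ]))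

  -- These are the lists `map f s` with `s` a face of `K`; the only candidate for `s` is `map g t`.
  -- The range condition excludes lists that become faces only through the values of `g` off the
  -- range.
  ImageFaces : SimplicialComplex E ℓ → Pred (List F) (b ⊔ ℓ)
  ImageFaces K t = map g t ∈ faces K × InRange t

  -- Stated up to `≐`, so that `K′` may live at a level other than that of `image K`.
  IsImage : SimplicialComplex F ℓ₂ → SimplicialComplex E ℓ₁ → Set (b ⊔ ℓ₁ ⊔ ℓ₂)
  IsImage K′ K = faces K′ ≐ ImageFaces K

  image : SimplicialComplex E ℓ → SimplicialComplex F (b ⊔ ℓ)
  image K .faces = ImageFaces K
  image K .nonempty (t∈ , _) refl = nonempty K t∈ refl
  image K .down-closed (t∈ , r) t′⊆t t′≢[] =
    down-closed K t∈ (map⁺ g t′⊆t) (map-≢[] g t′≢[]) , r ∘ t′⊆t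

  module _ {K : SimplicialComplex E ℓ₁} {K′ : SimplicialComplex F ℓ₂}
           (K′-image : IsImage K′ K) where

    map-face : ∀ {s} → s ∈ faces K → map f s ∈ faces K′
    map-face {s} s∈K = proj₂ K′-image
      (subst (_∈ faces K) (sym (map-g∘f s)) s∈K , map-InRange s)

    image-≅ : K ≅ K′
    image-≅ = record
      { to = f ; from = g
      ; to-simplicial = map-face
      ; from-simplicial = λ t∈ → proj₁ (proj₁ K′-image t∈)
      ; from∘to = λ {x} _ → g∘f x
      ; to∘from = λ y∈ → proj₂ (proj₁ K′-image y∈) (here refl) }

    Lk-map : ∀ {s u} → u ∈ Lk K s ∪ ｛ [] ｝ → map f u ∈ Lk K′ (map f s) ∪ ｛ [] ｝
    Lk-map (inj₂ refl) = inj₂ refl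
    Lk-map {s} {u} (inj₁ (u∈K , su∈K , disj)) = inj₁
      ( map-face u∈K , subst (_∈ faces K′) (map-++ f s u) (map-face su∈K) , disj′ )
      where
      disj′ : Disjoint (map f s) (map f u)
      disj′ (i , j) with x , x∈s , refl ← ∈-map⁻ f i | y , y∈u , e ← ∈-map⁻ f j =
        disj (x∈s , subst (_∈ₗ u) (sym (f-injective e)) y∈u)

    -- Faces of `K′` are in range, so `f` carries a common point `g y` of `s` and `map g u` back to
    -- `y`, which then lies in both `map f s` and `u`.
    Lk-unmap : ∀ {s u} → u ∈ Lk K′ (map f s) ∪ ｛ [] ｝ →
               InRange u × map g u ∈ Lk K s ∪ ｛ [] ｝
    Lk-unmap (inj₂ refl) = (λ ()) , inj₂ refl
    Lk-unmap {s} {u} (inj₁ (u∈ , su∈ , disj)) with gu∈K , r ← proj₁ K′-image u∈ =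
      r , inj₁ (gu∈K , subst (_∈ faces K) eq (proj₁ (proj₁ K′-image su∈)) , disj′)
      where
      eq : map g (map f s ++ u) ≡ s ++ map g u
      eq = trans (map-++ g (map f s) u) (cong (_++ map g u) (map-g∘f s))
      disj′ : Disjoint s (map g u)
      disj′ (i , j) with y , y∈u , refl ← ∈-map⁻ g j =
        disj (subst (_∈ₗ map f s) (r y∈u) (∈-map⁺ f i) , y∈u)

    -- The decomposition of `map g t` is pushed forward along `f`, and `InRange t` identifies
    -- `map f (map g t)` with `t`.
    stellarFaces-map : ∀ {s x t} → InRange t →
      map g t ∈ stellarFaces K s x → t ∈ stellarFaces K′ (map f s) (f x)
    stellarFaces-map {s} {t = t} r (inj₁ (gt∈K , s⊈gt)) = inj₁
      ( proj₂ K′-image (gt∈K , r)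
      , λ fs⊆t → s⊈gt (subst (_⊆ map g t) (map-g∘f s) (map⁺ g fs⊆t)) )
    stellarFaces-map {s} {x} {t} r (inj₂ (gt≢[] , u , v , w , u∈ , v∈ , w∈ , gt≋)) = inj₂
      ( (λ { refl → gt≢[] refl })
      , map f u , map f v , map f w , Lk-map u∈ , ∂-map v∈ , barycenter-map w∈
      , subst₂ _≋_ (map-f∘g r) map-++-++ (map-≋ f gt≋) )
      where
      map-++-++ : map f (u ++ v ++ w) ≡ map f u ++ map f v ++ map f w
      map-++-++ = trans (map-++ f u (v ++ w)) (cong (map f u ++_) (map-++ f v w))

    stellarFaces-unmap : ∀ {s x t} →
      t ∈ stellarFaces K′ (map f s) (f x) → map g t ∈ stellarFaces K s x × InRange t
    stellarFaces-unmap {s} (inj₁ (t∈ , fs⊈t)) with gt∈K , r ← proj₁ K′-image t∈ =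
      inj₁ (gt∈K , λ s⊆gt → fs⊈t (subst (map f s ⊆_) (map-f∘g r) (map⁺ f s⊆gt))) , r
    stellarFaces-unmap {s} {x} {t} (inj₂ (t≢[] , u , v , w , u∈ , v∈ , w∈ , t≋))
      with ru , gu∈ ← Lk-unmap u∈ | rv , gv∈ ← ∂-unmap {s} v∈ | rw , gw∈ ← barycenter-unmap w∈
      = inj₂ ( map-≢[] g t≢[] , map g u , map g v , map g w , gu∈ , gv∈ , gw∈
             , subst (map g t ≋_) map-++-++ (map-≋ g t≋) )
      -- Each point of `t` lies in the link, boundary or barycenter part, and all three are in
      -- range; for the last this uses that the new vertex is `f x`.
      , λ y∈t → [ ru , [ rv , rw ]′ ∘ ∈-++⁻ v ]′ (∈-++⁻ u (Equivalence.to t≋ y∈t))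
      where
      map-++-++ : map g (u ++ v ++ w) ≡ map g u ++ map g v ++ map g w
      map-++-++ = trans (map-++ g u (v ++ w)) (cong (map g u ++_) (map-++ g v w))

  -- `L′` and the subdivision of `K′` at `map f s` with barycenter `f x` are both images of the
  -- subdivision of `K`, hence have the same faces.
  image-subdivision :
    {K L : SimplicialComplex E ℓ₁} {K′ L′ : SimplicialComplex F ℓ₂} →
    IsImage K′ K → IsImage L′ L → IsStellarSubdivision L K → IsStellarSubdivision L′ K′
  image-subdivision {K = K} {K′ = K′} kI lI (s , x , s∈K , x∉K , L≐) =
    map f s , f x , map-face {K = K} {K′ = K′} kI s∈K
    -- If `f x` were a vertex of `K′`, then `g (f x)`, which is `x`, would be a vertex of `K`.
    , (λ fx∈ → x∉K (subst (_∈ faces K) (map-g∘f [ x ]) (proj₁ (proj₁ kI fx∈))))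
    , (λ t∈L′ → let gt∈L , r = proj₁ lI t∈L′ in
         stellarFaces-map {K = K} {K′ = K′} kI r (proj₁ L≐ gt∈L))
    , (λ t∈σ → let gt∈σ , r = stellarFaces-unmap {K = K} {K′ = K′} kI t∈σ in
         proj₂ lI (proj₂ L≐ gt∈σ , r))

  image-move :
    {K L : SimplicialComplex E ℓ₁} {K′ L′ : SimplicialComplex F ℓ₂} →
    IsImage K′ K → IsImage L′ L → StellarMove K L → StellarMove K′ L′
  image-move {K = K} {L} {K′} {L′} kI lI (subdivision σ) =
    subdivision (image-subdivision {K = K} {L} {K′} {L′} kI lI σ)
  image-move {K = K} {L} {K′} {L′} kI lI (weld σ) =
    weld (image-subdivision {K = L} {K} {L′} {K′} lI kI σ)
  -- The isomorphism is conjugated by those between complexes and their images.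
  image-move kI lI (iso i) =
    iso (≅-trans (≅-sym (image-≅ kI)) (≅-trans i (image-≅ lI)))

-- The image of a complex at level ℓ₁ lives at level b ⊔ ℓ₁, whereas the moves
-- over F are between complexes at level ℓ₂: excluded middle bridges the gap by
-- making membership a Boolean.

module _ (dec : (P : Set ℓ₁) → Dec P) (K : SimplicialComplex E ℓ₁) where

  resize : (ℓ₂ : Level) → SimplicialComplex E ℓ₂
  resize ℓ₂ .faces s = Lift ℓ₂ (True (dec (s ∈ faces K)))
  resize ℓ₂ .nonempty (lift s∈) = nonempty K (toWitness s∈)
  resize ℓ₂ .down-closed (lift s∈) t⊆s t≢[] =
    lift (fromWitness (down-closed K (toWitness s∈) t⊆s t≢[]))

  resize-≐ : faces (resize ℓ₂) ≐ faces K
  resize-≐ = (λ s∈ → toWitness (lower s∈)) , λ s∈ → lift (fromWitness s∈)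

-- Excluded middle is assumed at one large level but applied at two smaller ones: to build the
-- retraction and to decide faces of images.
lowerEM : (ℓ′ : Level) → ExcludedMiddle (ℓ ⊔ ℓ′) → (P : Set ℓ) → Dec P
lowerEM ℓ′ em P = map′ lower lift (em {Lift ℓ′ P})

injection⇒split : ((P : Set (a ⊔ b)) → Dec P) → {E : Set a} {F : Set b} →
  (f : E → F) → Injective _≡_ _≡_ f → (F → E) → ∃[ g ] (∀ x → g (f x) ≡ x)
injection⇒split dec {E} {F} f f-inj default = g , g∘f
  where
  g : F → E
  g y with dec (∃[ x ] f x ≡ y)
  ... | yes (x , _) = x
  -- Any value works off the range. A default function, unlike a default point, also covers an empty
  -- `E`, where `F` is then empty too.
  ... | no _        = default y
  g∘f : ∀ x → g (f x) ≡ x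
  g∘f x with dec (∃[ x′ ] f x′ ≡ f x)
  ... | yes (_ , e) = f-inj e
  ... | no ∄x       = contradiction (x , refl) ∄x

theorem3p2 : ∀ {a b ℓ₁ ℓ₂ : Level} → ExcludedMiddle (a ⊔ b ⊔ ℓ₁ ⊔ ℓ₂) →
    (E : Set a) (F : Set b)
    (K L : SimplicialComplex E ℓ₁) (Z W : SimplicialComplex F ℓ₂) →
    K ≅ Z → L ≅ W →
    (f : E → F) → Injective _≡_ _≡_ f →
    K ≅st L → Z ≅st W
theorem3p2 {a} {b} {ℓ₁} {ℓ₂} em E F K L Z W K≅Z L≅W f f-inj K≅stL =
  iso (≅-trans (≅-sym K≅Z) (image-≅ (im-isImage K)))
    ◅ im-≅st K≅stL
    ◅◅ iso (≅-trans (≅-sym (image-≅ (im-isImage L))) L≅W) ◅ ε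
  where
  retraction = injection⇒split (lowerEM (a ⊔ b ⊔ ℓ₁ ⊔ ℓ₂) em) f f-inj (_≅_.from K≅Z)
  open SplitInjection f (proj₁ retraction) (proj₂ retraction)

  dec : (P : Set (b ⊔ ℓ₁)) → Dec P
  dec = lowerEM (a ⊔ b ⊔ ℓ₁ ⊔ ℓ₂) em

  im : SimplicialComplex E ℓ₁ → SimplicialComplex F ℓ₂
  im M = resize dec (image M) ℓ₂

  im-isImage : ∀ M → IsImage (im M) M
  im-isImage M = resize-≐ dec (image M)

  -- All intermediate complexes are pushed forward along the same `f`, so the transported moves
  -- still compose.
  im-≅st : ∀ {M N} → M ≅st N → im M ≅st im N
  im-≅st ε = ε
  im-≅st (_◅_ {i = M} {j = M′} m ms) =
    image-move (im-isImage M) (im-isImage M′) m ◅ im-≅st ms
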